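{- Let $X$ be a connected bipartite vertex-transitive graph of order $n$ that is regular of degree $d$. Let $V(X)=V_1\cup V_2$ be the bipartition of the vertex set, and let $G\le\mathrm{Aut}(X)$ be a subgroup acting transitively on $V(X)$. Suppose there exists a block $B\subset V(X)$ for the action of $G$ such that $|B|=\frac{n}{2d}$ and $B\subseteq V_1$, and there is a vertex $v\in B$ such that $N(v)\cap B^g$ is nonempty for exactly $d$ different blocks $B^g$, $g\in G$. Then $X$ is a $d$-RDR graph. Moreover, if such a block exists, it is an orbit of a subgroup $H\le G$ whose order satisfies $|H|\equiv 0\pmod{\frac{n}{2d}}$ and which contains the vertex-stabilizer $G_v$.
   Context: All graphs are finite and simple. For a graph $G=(V,E)$, $N(v)$ is the open neighbourhood of $v$. Let $\mathcal K=\{1,\dots,k\}$. A $k$-rainbow dominating function ($k$-RDF) on a graph is a map $f\colon V\to 2^{\mathcal K}$ such that $f(v)=\emptyset$ implies $\bigcup_{u\in N(v)}f(u)=\mathcal K$, for all $v\in V$. Its weight is $\sum_{v\in V}|f(v)|$, and $\gamma_{rk}$ denotes the minimum weight of a $k$-RDF on the graph. It is known that a $d$-regular graph of order $n$ satisfies $\gamma_{rd}\ge n/2$; it is called $d$-rainbow domination regular ($d$-RDR) if $\gamma_{rd}=n/2$. A graph is vertex-transitive if its automorphism group acts transitively on its vertices. For $g\in G$, $B^g$ denotes the image of $B$ under $g$. A block for the action of a transitive group $G$ is a nonempty subset $B$ such that for every $g\in G$ either $B^g=B$ or $B^g\cap B=\emptyset$. -}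

module Defs where

open import Level using (0ℓ)
open import Data.Nat using (ℕ; _*_; _≤_)
open import Data.Nat.Properties using (+-0-commutativeMonoid)
open import Algebra.Properties.CommutativeMonoid.Sum +-0-commutativeMonoid using (sum)
open import Data.Fin using (Fin)
open import Data.Fin.Permutation as Perm
  using (Permutation′; _⟨$⟩ʳ_; _⟨$⟩ˡ_; _∘ₚ_; flip)
open import Data.Fin.Subset
  using (Subset; _∈_; _∩_; _∪_; ⋃; ⊤; ⊥; ∣_∣; Nonempty; Empty)
open import Data.Fin.Subset.Properties using (_∈?_)
open import Data.List using (allFin; filter; map)
open import Data.Vec using (tabulate; lookup)
open import Data.Product using (Σ; ∃; _×_; proj₁)
open import Data.Sum using (_⊎_)
open import Function.Bundles using (Inverse; _⇔_)
open import Relation.Nullary using (¬_; does)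
open import Relation.Unary using (Pred) renaming (Decidable to Decidable₁)
open import Relation.Binary using (Rel; Setoid; Decidable; Symmetric)
open import Relation.Binary.Construct.Closure.ReflexiveTransitive using (Star)
import Relation.Binary.Construct.On as On
open import Relation.Binary.PropositionalEquality as ≡ using (_≡_)

private
  variable
    n : ℕ

-- The subset of S cut out by P has exactly k elements.  Elements are compared
-- by the equality of S only, so the proofs of P do not contribute to the count.
HasCardinality : (S : Setoid 0ℓ 0ℓ) → (Setoid.Carrier S → Set) → ℕ → Set
HasCardinality S P k =
  Inverse (≡.setoid (Fin k)) (On.setoid {B = Σ (Setoid.Carrier S) P} S proj₁)

record Graph (n : ℕ) : Set₁ where
  field
    Adj    : Rel (Fin n) 0ℓ
    adj?   : Decidable Adj
    symm   : Symmetric Adj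
    irrefl : ∀ v → ¬ Adj v v

open Graph public

N : Graph n → Fin n → Subset n
N X v = tabulate λ u → does (adj? X v u)

IsRegular : Graph n → ℕ → Set
IsRegular X d = ∀ v → ∣ N X v ∣ ≡ d

IsConnected : Graph n → Set
IsConnected X = ∀ u v → Star (Adj X) u v

IsBipartition : Graph n → Subset n → Subset n → Set
IsBipartition X V₁ V₂ =
    V₁ ∪ V₂ ≡ ⊤
  × V₁ ∩ V₂ ≡ ⊥
  × (∀ u v → Adj X u v → (u ∈ V₁ × v ∈ V₂) ⊎ (u ∈ V₂ × v ∈ V₁))

IsRDF : ∀ k → Graph n → (Fin n → Subset k) → Set
IsRDF {n} k X f =
  ∀ v → f v ≡ ⊥ → ⋃ (map f (filter (_∈? N X v) (allFin n))) ≡ ⊤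

weight : ∀ {k} → (Fin n → Subset k) → ℕ
weight f = sum λ v → ∣ f v ∣

-- γ is the minimum weight of a k-RDF on X, i.e. γ = γ_rk(X).
IsRainbowDominationNumber : ∀ k → Graph n → ℕ → Set
IsRainbowDominationNumber k X γ =
    (∃ λ f → IsRDF k X f × weight f ≡ γ)
  × (∀ f → IsRDF k X f → γ ≤ weight f)

IsRDR : ℕ → Graph n → Set
IsRDR {n} d X =
    IsRegular X d
  × ∃ λ γ → IsRainbowDominationNumber d X γ × 2 * γ ≡ n

IsAutomorphism : Graph n → Permutation′ n → Set
IsAutomorphism X g = ∀ u v → Adj X u v ⇔ Adj X (g ⟨$⟩ʳ u) (g ⟨$⟩ʳ v)

IsVertexTransitive : Graph n → Set
IsVertexTransitive X =
  ∀ u v → ∃ λ g → IsAutomorphism X g × g ⟨$⟩ʳ u ≡ v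

Perms : ℕ → Setoid 0ℓ 0ℓ
Perms n = record
  { Carrier       = Permutation′ n
  ; _≈_           = Perm._≈_
  ; isEquivalence = record
    { refl  = λ _ → ≡.refl
    ; sym   = λ p i → ≡.sym (p i)
    ; trans = λ p q i → ≡.trans (p i) (q i)
    }
  }

-- Subgroups of the (finite) symmetric group on Fin n.  Decidable membership is
-- automatic classically and is what makes a subgroup finite constructively.
record Subgroup (n : ℕ) : Set₁ where
  field
    Member    : Pred (Permutation′ n) 0ℓ
    member?   : Decidable₁ Member
    resp      : ∀ {g h} → g Perm.≈ h → Member g → Member h
    id∈       : Member Perm.id
    ∘-closed  : ∀ {g h} → Member g → Member h → Member (g ∘ₚ h)
    ⁻¹-closed : ∀ {g} → Member g → Member (flip g)

open Subgroup public

infix 4 _∈ₛ_ _≤ₛ_ _≤Aut_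

_∈ₛ_ : Permutation′ n → Subgroup n → Set
g ∈ₛ G = Member G g

_≤ₛ_ : Subgroup n → Subgroup n → Set
H ≤ₛ G = ∀ g → g ∈ₛ H → g ∈ₛ G

_≤Aut_ : Subgroup n → Graph n → Set
G ≤Aut X = ∀ g → g ∈ₛ G → IsAutomorphism X g

HasOrder : Subgroup n → ℕ → Set
HasOrder {n} G = HasCardinality (Perms n) (Member G)

IsTransitive : Subgroup n → Set
IsTransitive G = ∀ u v → ∃ λ g → g ∈ₛ G × g ⟨$⟩ʳ u ≡ v

-- x ∈ B ^ g exactly when g⁻¹ x ∈ B.
infixl 8 _^_

_^_ : Subset n → Permutation′ n → Subset n
B ^ g = tabulate λ x → lookup B (g ⟨$⟩ˡ x)

IsBlock : Subgroup n → Subset n → Set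
IsBlock G B =
    Nonempty B
  × (∀ g → g ∈ₛ G → (B ^ g ≡ B) ⊎ Empty (B ^ g ∩ B))

MeetsExactly : Graph n → Subgroup n → Subset n → Fin n → ℕ → Set
MeetsExactly {n} X G B v =
  HasCardinality (≡.setoid (Subset n)) λ C →
    (∃ λ g → g ∈ₛ G × B ^ g ≡ C) × Nonempty (N X v ∩ C)

IsOrbit : Subgroup n → Subset n → Set
IsOrbit H B =
  ∃ λ w → ∀ u → u ∈ B ⇔ (∃ λ h → h ∈ₛ H × h ⟨$⟩ʳ w ≡ u)

ContainsStabilizer : Subgroup n → Subgroup n → Fin n → Set
ContainsStabilizer H G v = ∀ g → g ∈ₛ G → g ⟨$⟩ʳ v ≡ v → g ∈ₛ H

{-# OPTIONS --safe #-}
-- Let e₁, …, e_d ∈ G be such that the translates of B meeting N(v) are the eᵢ B.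
-- They are disjoint and lie in the side opposite to v, and g moves them to d
-- disjoint translates that meet N(g v) and lie in the side opposite to g v.  As
-- both sides then have at least d |B| = n / 2 elements, they have exactly n / 2,
-- and every translate of B inside V₁ meets the neighbourhood of every vertex
-- outside V₁.  Giving the vertices of the i-th translate inside V₁ the colour i
-- (and no colour to the other vertices) is therefore a d-RDF of weight n / 2.
--
-- Conversely, d |f(v)| + Σ_{u ∈ N(v)} |f(u)| ≥ d for every d-RDF f and every v;
-- summing over v gives 2 d · weight f ≥ d n.
--
-- The subgroup H is the setwise stabilizer of B.
module Submission where

open import Defs
open import Level using (0ℓ)
open import Algebra.Properties.Semiring.Sum using (*-distribˡ-sum; *-distribʳ-sum)
open import Data.Bool using (Bool; true; false; not; _xor_)
open import Data.Bool.Properties using (not-distribˡ-xor; xor-same)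
import Data.Bool.Properties as Bool
open import Data.Nat using (ℕ; zero; suc; _+_; _*_; _≤_; z≤n; NonZero)
open import Data.Nat.Properties
  using (≤-reflexive; ≤-trans; ≤-antisym; <-irrefl; n≤1+n; m≤m+n; m≤n+m; +-suc; +-identityʳ
        ; +-mono-≤; +-monoʳ-≤; *-identityˡ; *-identityʳ; *-comm; *-distribˡ-+; *-monoʳ-≤; *-assoc
        ; *-zeroʳ; *-cancelˡ-≤; *-cancelʳ-≤; +-cancelˡ-≤; m≤o∸n⇒m+n≤o
        ; +-0-commutativeMonoid; +-*-semiring; module ≤-Reasoning)
open import Algebra.Properties.CommutativeMonoid.Sum +-0-commutativeMonoid
  using (sum; sum-cong-≗; ∑-distrib-+; ∑-comm)
open import Data.Nat.Divisibility using (_∣_; m∣m*n)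
open import Data.Fin using (Fin; zero; suc; remQuot; combine; funToFin; finToFun)
open import Data.Fin.Properties
  using (_≟_; any?; all?; injective⇒≤; remQuot-combine; combine-remQuot
        ; funToFin-finToFin; finToFun-funToFin; suc-injective; nonZeroIndex; ¬Fin0)
open import Data.Fin.Permutation as Perm
  using (Permutation′; _⟨$⟩ʳ_; _⟨$⟩ˡ_; _∘ₚ_; flip; permutation; inverseˡ; inverseʳ)
open import Data.Fin.Subset
  using (Subset; inside; outside; _∈_; _∉_; _⊆_; _∪_; ⋃; ⊤; ⊥; ⁅_⁆; ∣_∣)
open import Data.Fin.Subset.Properties
  using (_∈?_; nonempty?; Empty-unique; ∣⊥∣≡0; ∣⊤∣≡n; ∣⁅x⁆∣≡1; x∈⁅x⁆; x∈⁅y⁆⇒x≡y; ∉⊥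
        ; ∣p∣≤n; p⊆q⇒∣p∣≤∣q∣; ⊆⊤; ⊆-antisym; x∈p∩q⁺; x∈p∩q⁻; x∈p∪q⁺; ∣∁p∣≡n∸∣p∣; x∉p⇒x∈∁p)
open import Data.List as List using (filter)
import Data.List.Membership.Propositional as Listₘ
open import Data.List.Membership.Propositional.Properties using (∈-map⁺; ∈-filter⁺; ∈-allFin)
open import Data.List.Relation.Unary.Any using (here; there)
open import Data.Vec using ([]; _∷_; tabulate; lookup; here; there)
open import Data.Vec.Properties
  using (≡-dec; []=⇒lookup; lookup⇒[]=; lookup∘tabulate; tabulate∘lookup; tabulate-cong)
open import Data.Product using (∃; _×_; _,_; proj₁; proj₂)
open import Data.Sum using (inj₁; inj₂)
open import Function using (_∘_; case_of_)
open import Function.Bundles using (_⇔_; mk⇔; Equivalence; Inverse)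
open import Function.Definitions using (Injective)
open import Relation.Binary using (Setoid)
open import Relation.Binary.Construct.Closure.ReflexiveTransitive using (Star; ε; _◅_)
open import Relation.Binary.PropositionalEquality as ≡
  using (_≡_; _≗_; refl; sym; trans; cong; cong₂; subst)
open import Relation.Nullary using (Dec; yes; no; does; contradiction)
open import Relation.Nullary.Decidable using (_×-dec_; map′; dec-true; does-⇔)
open import Relation.Unary using (Pred; Decidable)

private
  variable
    n k : ℕ

-- Subsets and cardinalities

module _ {P : Pred (Fin n) 0ℓ} (P? : Decidable P) where

  ∈-tabulate⁺ : ∀ {x} → P x → x ∈ tabulate (does ∘ P?)
  ∈-tabulate⁺ {x} px =
    lookup⇒[]= x _ (trans (lookup∘tabulate (does ∘ P?) x) (dec-true (P? x) px))

  ∈-tabulate⁻ : ∀ {x} → x ∈ tabulate (does ∘ P?) → P x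
  ∈-tabulate⁻ {x} x∈ with P? x | trans (sym (lookup∘tabulate (does ∘ P?) x)) ([]=⇒lookup x∈)
  ... | yes px | _ = px
  ... | no  _  | ()

x∈p⇒1≤∣p∣ : ∀ {x} {p : Subset n} → x ∈ p → 1 ≤ ∣ p ∣
x∈p⇒1≤∣p∣ {x = x} {p} x∈p = subst (_≤ ∣ p ∣) (∣⁅x⁆∣≡1 x)
  (p⊆q⇒∣p∣≤∣q∣ λ y∈ → subst (_∈ p) (sym (x∈⁅y⁆⇒x≡y x y∈)) x∈p)

∣p∪q∣≤∣p∣+∣q∣ : ∀ (p q : Subset n) → ∣ p ∪ q ∣ ≤ ∣ p ∣ + ∣ q ∣
∣p∪q∣≤∣p∣+∣q∣ []            []            = z≤n
∣p∪q∣≤∣p∣+∣q∣ (outside ∷ p) (outside ∷ q) = ∣p∪q∣≤∣p∣+∣q∣ p q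
∣p∪q∣≤∣p∣+∣q∣ (outside ∷ p) (inside  ∷ q) =
  ≤-trans (+-monoʳ-≤ 1 (∣p∪q∣≤∣p∣+∣q∣ p q)) (≤-reflexive (sym (+-suc ∣ p ∣ ∣ q ∣)))
∣p∪q∣≤∣p∣+∣q∣ (inside  ∷ p) (outside ∷ q) = +-monoʳ-≤ 1 (∣p∪q∣≤∣p∣+∣q∣ p q)
∣p∪q∣≤∣p∣+∣q∣ (inside  ∷ p) (inside  ∷ q) =
  +-monoʳ-≤ 1 (≤-trans (∣p∪q∣≤∣p∣+∣q∣ p q) (+-monoʳ-≤ ∣ p ∣ (n≤1+n ∣ q ∣)))

x∈⋃⁺ : ∀ {x} {p : Subset n} {ps} → p Listₘ.∈ ps → x ∈ p → x ∈ ⋃ ps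
x∈⋃⁺ (here refl)  x∈p = x∈p∪q⁺ (inj₁ x∈p)
x∈⋃⁺ (there p∈ps) x∈p = x∈p∪q⁺ (inj₂ (x∈⋃⁺ p∈ps x∈p))

module Cardinality {S : Setoid 0ℓ 0ℓ} {P : Setoid.Carrier S → Set} (c : HasCardinality S P k) where
  open Setoid S using (Carrier; _≈_)

  element : Fin k → Carrier
  element i = proj₁ (Inverse.to c i)

  element∈ : ∀ i → P (element i)
  element∈ i = proj₂ (Inverse.to c i)

  element-injective : ∀ {i j} → element i ≈ element j → i ≡ j
  element-injective {i} {j} eq = begin
    i                               ≡⟨ Inverse.strictlyInverseʳ c i ⟨
    Inverse.from c (Inverse.to c i) ≡⟨ Inverse.from-cong c eq ⟩
    Inverse.from c (Inverse.to c j) ≡⟨ Inverse.strictlyInverseʳ c j ⟩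
    j                               ∎
    where open ≡.≡-Reasoning

  index : ∀ {x} → P x → Fin k
  index {x} px = Inverse.from c (x , px)

  element-index : ∀ {x} (px : P x) → element (index px) ≈ x
  element-index {x} px = Inverse.strictlyInverseˡ c (x , px)

module _ (S : Setoid 0ℓ 0ℓ) where
  open Setoid S using (Carrier; _≈_) renaming (refl to ≈-refl; trans to ≈-trans; sym to ≈-sym)

  -- The preimage chosen by `surj` may depend on the proof of `P x`; `inj` shows that its value does
  -- not, so `from` respects an equality that forgets proofs.
  hasCardinality : {P : Carrier → Set} (e : Fin k → Carrier) →
                   (∀ i → P (e i)) → (∀ {i j} → e i ≈ e j → i ≡ j) →
                   (∀ {x} → P x → ∃ λ i → e i ≈ x) → HasCardinality S P k
  hasCardinality e e∈ inj surj = record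
    { to        = λ i → e i , e∈ i
    ; from      = λ (_ , px) → proj₁ (surj px)
    ; to-cong   = λ { refl → ≈-refl }
    ; from-cong = λ {(_ , px)} {(_ , py)} eq → inj
        (≈-trans (proj₂ (surj px)) (≈-trans eq (≈-sym (proj₂ (surj py)))))
    ; inverse   = (λ {(_ , px)} → λ { refl → proj₂ (surj px) })
                , λ {i} {(_ , py)} eq → inj (≈-trans (proj₂ (surj py)) eq)
    }

subset-cardinality : (p : Subset n) → HasCardinality (≡.setoid (Fin n)) (_∈ p) ∣ p ∣
subset-cardinality p =
  hasCardinality (≡.setoid _) (nth p) (nth∈ p) (nth-injective p) (nth-surjective p)
  where
  nth : (p : Subset n) → Fin ∣ p ∣ → Fin n
  nth (inside  ∷ p) zero    = zero
  nth (inside  ∷ p) (suc i) = suc (nth p i)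
  nth (outside ∷ p) i       = suc (nth p i)

  nth∈ : (p : Subset n) → ∀ i → nth p i ∈ p
  nth∈ (inside  ∷ p) zero    = here
  nth∈ (inside  ∷ p) (suc i) = there (nth∈ p i)
  nth∈ (outside ∷ p) i       = there (nth∈ p i)

  nth-injective : (p : Subset n) → ∀ {i j} → nth p i ≡ nth p j → i ≡ j
  nth-injective (inside  ∷ p) {zero}  {zero}  eq = refl
  nth-injective (inside  ∷ p) {suc i} {suc j} eq = cong suc (nth-injective p (suc-injective eq))
  nth-injective (outside ∷ p)                 eq = nth-injective p (suc-injective eq)

  nth-surjective : (p : Subset n) → ∀ {x} → x ∈ p → ∃ λ i → nth p i ≡ x
  nth-surjective (inside  ∷ p) here       = zero , refl
  nth-surjective (inside  ∷ p) (there x∈) = case nth-surjective p x∈ of λ { (i , refl) → suc i , refl }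
  nth-surjective (outside ∷ p) (there x∈) = case nth-surjective p x∈ of λ { (i , refl) → i , refl }

module _ {p : Subset n} {φ : Fin k → Fin n}
         (φ-injective : Injective _≡_ _≡_ φ) (φ∈p : ∀ i → φ i ∈ p) where

  open Cardinality (subset-cardinality p)

  injective⇒≤∣p∣ : k ≤ ∣ p ∣
  injective⇒≤∣p∣ = injective⇒≤ {f = λ i → index (φ∈p i)} λ {i} {j} eq → φ-injective
    (trans (sym (element-index (φ∈p i))) (trans (cong element eq) (element-index (φ∈p j))))

-- If `x` were missed, adjoining it to the values of `φ` would inject `suc k` indices into a set of
-- at most `k` elements.
injective⇒onto : ∀ {p : Subset n} {φ : Fin k → Fin n} → Injective _≡_ _≡_ φ → (∀ i → φ i ∈ p) →
                 ∣ p ∣ ≤ k → ∀ {x} → x ∈ p → ∃ λ i → φ i ≡ x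
injective⇒onto {n} {k} {p} {φ} φ-injective φ∈p ∣p∣≤k {x} x∈p with any? (λ i → φ i ≟ x)
... | yes hit = hit
... | no ¬hit = contradiction (≤-trans (injective⇒≤∣p∣ ψ-injective ψ∈p) ∣p∣≤k) (<-irrefl refl)
  where
  ψ : Fin (suc k) → Fin n
  ψ zero    = x
  ψ (suc i) = φ i

  ψ-injective : Injective _≡_ _≡_ ψ
  ψ-injective {zero}  {zero}  eq = refl
  ψ-injective {zero}  {suc j} eq = contradiction (j , sym eq) ¬hit
  ψ-injective {suc i} {zero}  eq = contradiction (i , eq) ¬hit
  ψ-injective {suc i} {suc j} eq = cong suc (φ-injective eq)

  ψ∈p : ∀ i → ψ i ∈ p
  ψ∈p zero    = x∈p
  ψ∈p (suc i) = φ∈p i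

-- The lower bound on the weight

⟦_⟧ : Bool → ℕ
⟦ true  ⟧ = 1
⟦ false ⟧ = 0

∑-mono-≤ : ∀ {f g : Fin n → ℕ} → (∀ i → f i ≤ g i) → sum f ≤ sum g
∑-mono-≤ {zero}  f≤g = z≤n
∑-mono-≤ {suc n} f≤g = +-mono-≤ (f≤g zero) (∑-mono-≤ (f≤g ∘ suc))

∑-const : ∀ n c → sum {n} (λ _ → c) ≡ n * c
∑-const zero    c = refl
∑-const (suc n) c = cong (c +_) (∑-const n c)

∣p∣≡∑ : (p : Subset n) → ∣ p ∣ ≡ sum λ i → ⟦ lookup p i ⟧
∣p∣≡∑ []            = refl
∣p∣≡∑ (inside  ∷ p) = cong suc (∣p∣≡∑ p)
∣p∣≡∑ (outside ∷ p) = ∣p∣≡∑ p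

-- Subadditivity of cardinality, by induction on `l`. The arbitrary `h` lets the induction pass to
-- `h ∘ suc`; the sum over a neighbourhood is the case where `h` is the identity.
∣⋃-filter∣≤∑ : ∀ {l} (f : Fin n → Subset k) (p : Subset n) (h : Fin l → Fin n) →
  ∣ ⋃ (List.map f (filter (_∈? p) (List.tabulate h))) ∣ ≤ sum λ i → ⟦ lookup p (h i) ⟧ * ∣ f (h i) ∣
∣⋃-filter∣≤∑ {k = k} {zero} f p h = ≤-reflexive (∣⊥∣≡0 k)
∣⋃-filter∣≤∑ {l = suc l} f p h with h zero ∈? p
... | no  _  = ≤-trans (∣⋃-filter∣≤∑ f p (h ∘ suc)) (m≤n+m _ _)
... | yes h∈ = begin
  ∣ f (h zero) ∪ ⋃ ps ∣
    ≤⟨ ∣p∪q∣≤∣p∣+∣q∣ (f (h zero)) _ ⟩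
  ∣ f (h zero) ∣ + ∣ ⋃ ps ∣
    ≤⟨ +-mono-≤ (≤-reflexive head) (∣⋃-filter∣≤∑ f p (h ∘ suc)) ⟩
  ⟦ lookup p (h zero) ⟧ * ∣ f (h zero) ∣ + _ ∎
  where
  open ≤-Reasoning
  ps = List.map f (filter (_∈? p) (List.tabulate (h ∘ suc)))
  head : ∣ f (h zero) ∣ ≡ ⟦ lookup p (h zero) ⟧ * ∣ f (h zero) ∣
  head = trans (sym (*-identityˡ _)) (cong (λ b → ⟦ b ⟧ * ∣ f (h zero) ∣) (sym ([]=⇒lookup h∈)))

module _ (X : Graph n) where

  ∈N⁺ : ∀ {u v} → Adj X v u → u ∈ N X v
  ∈N⁺ {v = v} = ∈-tabulate⁺ (adj? X v)

  ∈N⁻ : ∀ {u v} → u ∈ N X v → Adj X v u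
  ∈N⁻ {v = v} = ∈-tabulate⁻ (adj? X v)

  lookup-N-sym : ∀ u v → lookup (N X v) u ≡ lookup (N X u) v
  lookup-N-sym u v = begin
    lookup (N X v) u  ≡⟨ lookup∘tabulate (does ∘ adj? X v) u ⟩
    does (adj? X v u) ≡⟨ does-⇔ (mk⇔ (symm X) (symm X)) (adj? X v u) (adj? X u v) ⟩
    does (adj? X u v) ≡⟨ lookup∘tabulate (does ∘ adj? X u) v ⟨
    lookup (N X u) v  ∎
    where open ≡.≡-Reasoning

  -- Double counting: after exchanging the sums, each `w u` occurs once for every neighbour of `u`,
  -- that is `d` times.
  ∑-neighbours : ∀ {d} → IsRegular X d → (w : Fin n → ℕ) →
                 sum (λ v → sum λ u → ⟦ lookup (N X v) u ⟧ * w u) ≡ d * sum w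
  ∑-neighbours {d} reg w = begin
    sum (λ v → sum λ u → ⟦ lookup (N X v) u ⟧ * w u)
      ≡⟨ ∑-comm (λ v u → ⟦ lookup (N X v) u ⟧ * w u) ⟩
    sum (λ u → sum λ v → ⟦ lookup (N X v) u ⟧ * w u)
      ≡⟨ sum-cong-≗ (λ u → *-distribʳ-sum +-*-semiring (w u) λ v → ⟦ lookup (N X v) u ⟧) ⟨
    sum (λ u → sum (λ v → ⟦ lookup (N X v) u ⟧) * w u)
      ≡⟨ sum-cong-≗ (λ u → cong (_* w u) (trans (degree u) (reg u))) ⟩
    sum (λ u → d * w u)
      ≡⟨ *-distribˡ-sum +-*-semiring d w ⟨
    d * sum w ∎
    where
    open ≡.≡-Reasoning
    degree : ∀ u → sum (λ v → ⟦ lookup (N X v) u ⟧) ≡ ∣ N X u ∣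
    degree u = trans (sum-cong-≗ λ v → cong ⟦_⟧ (lookup-N-sym u v)) (sym (∣p∣≡∑ (N X u)))

  n≤2*weight : ∀ {d} .{{_ : NonZero d}} → IsRegular X d →
               ∀ {f} → IsRDF d X f → n ≤ 2 * weight f
  n≤2*weight {d} reg {f} rdf = *-cancelʳ-≤ n (2 * weight f) d (begin
    n * d
      ≡⟨ ∑-const n d ⟨
    sum {n} (λ _ → d)
      ≤⟨ ∑-mono-≤ local ⟩
    sum (λ v → d * ∣ f v ∣ + colours v)
      ≡⟨ ∑-distrib-+ (λ v → d * ∣ f v ∣) colours ⟩
    sum (λ v → d * ∣ f v ∣) + sum colours
      ≡⟨ cong₂ _+_ (sym (*-distribˡ-sum +-*-semiring d λ v → ∣ f v ∣)) (∑-neighbours reg λ v → ∣ f v ∣) ⟩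
    d * weight f + d * weight f
      ≡⟨ *-distribˡ-+ d (weight f) (weight f) ⟨
    d * (weight f + weight f)
      ≡⟨ cong (λ w → d * (weight f + w)) (+-identityʳ (weight f)) ⟨
    d * (2 * weight f)
      ≡⟨ *-comm d (2 * weight f) ⟩
    2 * weight f * d ∎)
    where
    open ≤-Reasoning
    colours : Fin n → ℕ
    colours v = sum λ u → ⟦ lookup (N X v) u ⟧ * ∣ f u ∣

    -- At a coloured vertex the first summand is already at least `d`; at an uncoloured one the
    -- neighbours must show all `d` colours.
    local : ∀ v → d ≤ d * ∣ f v ∣ + colours v
    local v with nonempty? (f v)
    ... | yes (_ , i∈) = ≤-trans (subst (_≤ d * ∣ f v ∣) (*-identityʳ d) (*-monoʳ-≤ d (x∈p⇒1≤∣p∣ i∈)))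
                                 (m≤m+n _ _)
    ... | no  empty    = begin
      d               ≡⟨ ∣⊤∣≡n d ⟨
      ∣ ⊤ {n = d} ∣   ≡⟨ cong ∣_∣ (rdf v (Empty-unique empty)) ⟨
      _               ≤⟨ ∣⋃-filter∣≤∑ f (N X v) (λ u → u) ⟩
      colours v       ≤⟨ m≤n+m _ _ ⟩
      d * ∣ f v ∣ + colours v ∎

-- Permutations

⟨$⟩ʳ-injective : (g : Permutation′ n) → ∀ {x y} → g ⟨$⟩ʳ x ≡ g ⟨$⟩ʳ y → x ≡ y
⟨$⟩ʳ-injective g eq = trans (sym (inverseˡ g)) (trans (cong (g ⟨$⟩ˡ_) eq) (inverseˡ g))

-- The relation `≈` compares forward maps only, whereas `B ^ g` is defined by the inverse map.
⟨$⟩ˡ-cong : ∀ {g h : Permutation′ n} → g Perm.≈ h → ∀ x → g ⟨$⟩ˡ x ≡ h ⟨$⟩ˡ x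
⟨$⟩ˡ-cong {g = g} {h} g≈h x = ⟨$⟩ʳ-injective h
  (trans (sym (g≈h _)) (trans (inverseʳ g) (sym (inverseʳ h))))

funToFin-cong : ∀ {m} {f g : Fin m → Fin n} → f ≗ g → funToFin f ≡ funToFin g
funToFin-cong {m = zero}  f≗g = refl
funToFin-cong {m = suc m} f≗g = cong₂ combine (f≗g zero) (funToFin-cong (f≗g ∘ suc))

-- Maps on `Fin n` are coded by numbers, so the search for a two-sided inverse of `f` is a finite
-- search over codes.
permutation? : (f : Fin n → Fin n) → Dec (∃ λ (g : Permutation′ n) → ∀ x → g ⟨$⟩ʳ x ≡ f x)
permutation? f = map′
  (λ (_ , invˡ , invʳ) → permutation f (finToFun _) invˡ invʳ , λ _ → refl)
  (λ (g , g≈f) → let f⁻¹ = finToFun-funToFin (g ⟨$⟩ˡ_) in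
      funToFin (g ⟨$⟩ˡ_)
    , (λ y → trans (sym (g≈f _)) (trans (cong (g ⟨$⟩ʳ_) (f⁻¹ y)) (inverseʳ g)))
    , (λ x → trans (f⁻¹ (f x)) (trans (cong (g ⟨$⟩ˡ_) (sym (g≈f x))) (inverseˡ g))))
  (any? λ c → all? (λ y → f (finToFun c y) ≟ y) ×-dec all? (λ x → finToFun c (f x) ≟ x))

-- Permutations satisfying `P` are counted by the codes of their forward maps. A permutation
-- recovered from a code agrees with the original only pointwise, hence `P-resp`.
perms-finite : {P : Permutation′ n → Set} → Decidable P →
               (∀ {g h} → g Perm.≈ h → P g → P h) → ∃ λ k → HasCardinality (Perms n) P k
perms-finite {n} {P} P? P-resp = ∣ codes ∣ , hasCardinality (Perms n)
  (λ i → proj₁ (decode i))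
  (λ i → proj₁ (proj₂ (decode i)))
  (λ {i} {j} eq → element-injective (trans (sym (funToFin-finToFin {n} {n} (element i)))
    (trans (funToFin-cong λ x → trans (sym (proj₂ (proj₂ (decode i)) x))
                                      (trans (eq x) (proj₂ (proj₂ (decode j)) x)))
           (funToFin-finToFin {n} {n} (element j)))))
  λ {g} pg →
    let c∈ = ∈-tabulate⁺ Code? (g , pg , λ x → sym (finToFun-funToFin (g ⟨$⟩ʳ_) x))
    in index c∈ , λ x → trans (proj₂ (proj₂ (decode (index c∈))) x)
         (trans (cong (λ c → finToFun c x) (element-index c∈)) (finToFun-funToFin (g ⟨$⟩ʳ_) x))
  where
  Code : Fin _ → Set
  Code c = ∃ λ g → P g × (∀ x → g ⟨$⟩ʳ x ≡ finToFun c x)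

  Code? : Decidable Code
  Code? c with permutation? (finToFun c)
  ... | no ¬g         = no λ (g , _ , g≈c) → ¬g (g , g≈c)
  -- Every permutation with code `c` agrees pointwise with the `g` found, so testing `g` alone
  -- decides.
  ... | yes (g , g≈c) = map′ (λ pg → g , pg , g≈c)
    (λ (h , ph , h≈c) → P-resp (λ x → trans (h≈c x) (sym (g≈c x))) ph) (P? g)

  codes : Subset _
  codes = tabulate (does ∘ Code?)

  open Cardinality (subset-cardinality codes)

  decode : ∀ i → Code (element i)
  decode i = ∈-tabulate⁻ Code? (element∈ i)

-- Orbits and stabilizers

module _ (H : Subgroup n) {B : Subset n} {v : Fin n}
         (orbit : ∀ u → u ∈ B ⇔ (∃ λ h → h ∈ₛ H × h ⟨$⟩ʳ v ≡ u)) where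

  -- Each element of `H` is, in exactly one way, an element of the stabilizer of `v` followed by a
  -- chosen `t j` taking `v` to the `j`-th point of `B`. Here `s` is the order of that stabilizer.
  orbit-stabilizer : ∃ λ s → HasOrder H (∣ B ∣ * s)
  orbit-stabilizer = s , hasCardinality (Perms n)
    (λ c → e (remQuot s c))
    (λ c → e∈ (remQuot s c))
    (λ {c} {c′} eq → trans (sym (combine-remQuot {∣ B ∣} s c))
      (trans (cong (λ (j , l) → combine j l) (e-injective {remQuot s c} {remQuot s c′} eq))
             (combine-remQuot {∣ B ∣} s c′)))
    λ {h} h∈ → let (j , l) , eq = e-surjective h∈ in combine j l ,
      λ x → trans (cong (λ c → e c ⟨$⟩ʳ x) (remQuot-combine j l)) (eq x)
    where
    Stab : Permutation′ n → Set
    Stab g = g ∈ₛ H × g ⟨$⟩ʳ v ≡ v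

    finite = perms-finite {P = Stab} (λ g → member? H g ×-dec (g ⟨$⟩ʳ v ≟ v))
      λ g≈h (g∈ , gv) → resp H g≈h g∈ , trans (sym (g≈h v)) gv

    s = proj₁ finite
    module S = Cardinality (proj₂ finite)
    module C = Cardinality (subset-cardinality B)

    translate : ∀ j → ∃ λ h → h ∈ₛ H × h ⟨$⟩ʳ v ≡ C.element j
    translate j = Equivalence.to (orbit _) (C.element∈ j)

    t : Fin ∣ B ∣ → Permutation′ n
    t j = proj₁ (translate j)

    e : Fin ∣ B ∣ × Fin s → Permutation′ n
    e (j , l) = S.element l ∘ₚ t j

    e∈ : ∀ c → e c ∈ₛ H
    e∈ (j , l) = ∘-closed H (proj₁ (S.element∈ l)) (proj₁ (proj₂ (translate j)))

    e-v : ∀ j l → e (j , l) ⟨$⟩ʳ v ≡ C.element j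
    e-v j l = trans (cong (t j ⟨$⟩ʳ_) (proj₂ (S.element∈ l))) (proj₂ (proj₂ (translate j)))

    e-injective : ∀ {c c′} → e c Perm.≈ e c′ → c ≡ c′
    e-injective {j , l} {j′ , l′} eq
      -- The image of `v` determines `j`; then `t j` cancels.
      with refl ← C.element-injective (trans (sym (e-v j l)) (trans (eq v) (e-v j′ l′)))
      = cong (j ,_) (S.element-injective λ x → ⟨$⟩ʳ-injective (t j) (eq x))

    e-surjective : ∀ {h} → h ∈ₛ H → ∃ λ c → e c Perm.≈ h
    e-surjective {h} h∈ = (j , S.index s∈) , λ x →
      trans (cong (t j ⟨$⟩ʳ_) (S.element-index s∈ x)) (inverseʳ (t j))
      where
      hv∈ = Equivalence.from (orbit _) (h , h∈ , refl)
      j = C.index hv∈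
      s∈ : Stab (h ∘ₚ flip (t j))
      s∈ = ∘-closed H h∈ (⁻¹-closed H (proj₁ (proj₂ (translate j))))
         , trans (cong (t j ⟨$⟩ˡ_) (trans (sym (C.element-index hv∈)) (sym (proj₂ (proj₂ (translate j))))))
                 (inverseˡ (t j))

-- Translates of a block

lookup-^ : ∀ (B : Subset n) g x → lookup (B ^ g) x ≡ lookup B (g ⟨$⟩ˡ x)
lookup-^ B g = lookup∘tabulate λ x → lookup B (g ⟨$⟩ˡ x)

∈^⁺ : ∀ (B : Subset n) g {x} → x ∈ B → g ⟨$⟩ʳ x ∈ B ^ g
∈^⁺ B g x∈B = lookup⇒[]= _ _
  (trans (lookup-^ B g _) (trans (cong (lookup B) (inverseˡ g)) ([]=⇒lookup x∈B)))

∈^⁻ : ∀ (B : Subset n) g {x} → x ∈ B ^ g → ∃ λ b → b ∈ B × g ⟨$⟩ʳ b ≡ x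
∈^⁻ B g {x} x∈ =
  g ⟨$⟩ˡ x , lookup⇒[]= _ _ (trans (sym (lookup-^ B g x)) ([]=⇒lookup x∈)) , inverseʳ g

module _ (G : Subgroup n) {B : Subset n} (block : IsBlock G B) where

  private
    -- Let `k` be `g` followed by the inverse of `h`. The preimage of `x` under `h` lies in both `B`
    -- and `B ^ k`, so the block property leaves only `B ^ k ≡ B`; applying `h` to this gives the
    -- inclusion.
    translate-⊆ : ∀ {g h x} → g ∈ₛ G → h ∈ₛ G → x ∈ B ^ g → x ∈ B ^ h → B ^ g ⊆ B ^ h
    translate-⊆ {g} {h} g∈ h∈ x∈Bg x∈Bh y∈Bg
      with proj₂ block (g ∘ₚ flip h) (∘-closed G g∈ (⁻¹-closed G h∈))
    ... | inj₁ fixed =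
      let b , b∈ , gb≡y = ∈^⁻ B g y∈Bg
      in subst (_∈ B ^ h) (trans (inverseʳ h) gb≡y)
           (∈^⁺ B h (subst (h ⟨$⟩ˡ (g ⟨$⟩ʳ b) ∈_) fixed (∈^⁺ B (g ∘ₚ flip h) b∈)))
    ... | inj₂ disjoint =
      let b  , b∈  , gb≡x  = ∈^⁻ B g x∈Bg
          b′ , b′∈ , hb′≡x = ∈^⁻ B h x∈Bh
          kb≡b′ = trans (cong (h ⟨$⟩ˡ_) (trans gb≡x (sym hb′≡x))) (inverseˡ h)
          b′∈Bk = subst (_∈ B ^ (g ∘ₚ flip h)) kb≡b′ (∈^⁺ B (g ∘ₚ flip h) b∈)
      in contradiction (b′ , x∈p∩q⁺ (b′∈Bk , b′∈)) disjoint

  translates-≡ : ∀ {g h x} → g ∈ₛ G → h ∈ₛ G → x ∈ B ^ g → x ∈ B ^ h → B ^ g ≡ B ^ h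
  translates-≡ g∈ h∈ x∈Bg x∈Bh =
    ⊆-antisym (translate-⊆ g∈ h∈ x∈Bg x∈Bh) (translate-⊆ h∈ g∈ x∈Bh x∈Bg)

-- The setwise stabilizer of a block

setwiseStabilizer : Subgroup n → Subset n → Subgroup n
setwiseStabilizer G B = record
  { Member    = λ g → g ∈ₛ G × B ^ g ≡ B
  ; member?   = λ g → member? G g ×-dec ≡-dec Bool._≟_ (B ^ g) B
  ; resp      = λ {g} {h} g≈h (g∈ , Bg) → resp G g≈h g∈
              , trans (tabulate-cong λ x → cong (lookup B) (sym (⟨$⟩ˡ-cong {g = g} {h} g≈h x))) Bg
  ; id∈       = id∈ G , tabulate∘lookup B
  ; ∘-closed  = λ {g} {h} (g∈ , Bg) (h∈ , Bh) → ∘-closed G g∈ h∈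
              , trans (tabulate-cong λ x → fixed g Bg (h ⟨$⟩ˡ x)) Bh
  ; ⁻¹-closed = λ {g} (g∈ , Bg) → ⁻¹-closed G g∈
              , trans (tabulate-cong λ x → trans (sym (fixed g Bg (g ⟨$⟩ʳ x))) (cong (lookup B) (inverseˡ g)))
                      (tabulate∘lookup B)
  }
  where
  fixed : ∀ g → B ^ g ≡ B → ∀ x → lookup B (g ⟨$⟩ˡ x) ≡ lookup B x
  fixed g Bg x = trans (sym (lookup-^ B g x)) (cong (λ C → lookup C x) Bg)

module _ (G : Subgroup n) (transitive : IsTransitive G)
         {B : Subset n} (block : IsBlock G B) {v} (v∈B : v ∈ B) where

  private
    H = setwiseStabilizer G B

    -- The point `g ⟨$⟩ʳ v` lies in both `B ^ g` and `B`, which excludes disjointness. Both claims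
    -- about the setwise stabilizer reduce to this.
    meets⇒fixes : ∀ g → g ∈ₛ G → g ⟨$⟩ʳ v ∈ B → g ∈ₛ H
    meets⇒fixes g g∈ gv∈B with proj₂ block g g∈
    ... | inj₁ fixed    = g∈ , fixed
    ... | inj₂ disjoint = contradiction (_ , x∈p∩q⁺ (∈^⁺ B g v∈B , gv∈B)) disjoint

  setwiseStabilizer-orbit : ∀ u → u ∈ B ⇔ (∃ λ h → h ∈ₛ H × h ⟨$⟩ʳ v ≡ u)
  setwiseStabilizer-orbit u = mk⇔
    (λ u∈B → let g , g∈ , gv≡u = transitive v u
             in g , meets⇒fixes g g∈ (subst (_∈ B) (sym gv≡u) u∈B) , gv≡u)
    (λ { (h , (_ , fixed) , refl) → subst (h ⟨$⟩ʳ v ∈_) fixed (∈^⁺ B h v∈B) })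

  setwiseStabilizer-stabilizer : ContainsStabilizer H G v
  setwiseStabilizer-stabilizer g g∈ gv≡v = meets⇒fixes g g∈ (subst (_∈ B) (sym gv≡v) v∈B)

-- Bipartitions

module Bipartition (X : Graph n) {V₁ V₂ : Subset n} (bipartition : IsBipartition X V₁ V₂) where

  side : Fin n → Bool
  side = lookup V₁

  side-false : ∀ {u} → u ∉ V₁ → side u ≡ false
  side-false {u} u∉ with side u in eq
  ... | true  = contradiction (lookup⇒[]= u V₁ eq) u∉
  ... | false = refl

  V₂⇒∉V₁ : ∀ {u} → u ∈ V₂ → u ∉ V₁
  V₂⇒∉V₁ u∈₂ u∈₁ = ∉⊥ (subst (_ ∈_) (proj₁ (proj₂ bipartition)) (x∈p∩q⁺ (u∈₁ , u∈₂)))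

  side-adj : ∀ {u v} → Adj X u v → side u ≡ not (side v)
  side-adj {u} {v} u~v with proj₂ (proj₂ bipartition) u v u~v
  ... | inj₁ (u∈₁ , v∈₂) = trans ([]=⇒lookup u∈₁) (cong not (sym (side-false (V₂⇒∉V₁ v∈₂))))
  ... | inj₂ (u∈₂ , v∈₁) = trans (side-false (V₂⇒∉V₁ u∈₂)) (cong not (sym ([]=⇒lookup v∈₁)))

  -- An automorphism may swap the sides, but it keeps "on different sides" (xor).
  automorphism-side : ∀ g → IsAutomorphism X g → ∀ {u v} → Star (Adj X) u v →
                      side (g ⟨$⟩ʳ u) xor side (g ⟨$⟩ʳ v) ≡ side u xor side v
  automorphism-side g aut {u} ε = trans (xor-same (side (g ⟨$⟩ʳ u))) (sym (xor-same (side u)))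
  automorphism-side g aut {u} {v} (_◅_ {j = w} u~w w⋯v) = begin
    side (g ⟨$⟩ʳ u) xor side (g ⟨$⟩ʳ v)
      ≡⟨ step (side (g ⟨$⟩ʳ v)) (side-adj (Equivalence.to (aut u w) u~w)) ⟩
    not (side (g ⟨$⟩ʳ w) xor side (g ⟨$⟩ʳ v))
      ≡⟨ cong not (automorphism-side g aut w⋯v) ⟩
    not (side w xor side v)
      ≡⟨ step (side v) (side-adj u~w) ⟨
    side u xor side v ∎
    where
    open ≡.≡-Reasoning
    step : ∀ {a b} c → a ≡ not b → a xor c ≡ not (b xor c)
    step {b = b} c refl = sym (not-distribˡ-xor b c)

-- The rainbow dominating function

module Rainbow
  {d : ℕ} (X : Graph n) (connected : IsConnected X) (regular : IsRegular X d)
  {V₁ V₂ : Subset n} (bipartition : IsBipartition X V₁ V₂)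
  (G : Subgroup n) (G≤X : G ≤Aut X) (transitive : IsTransitive G)
  {B : Subset n} (∣B∣*2d≡n : ∣ B ∣ * (2 * d) ≡ n) (block : IsBlock G B) (B⊆V₁ : B ⊆ V₁)
  {v : Fin n} (v∈B : v ∈ B) (meets : MeetsExactly X G B v d)
  -- Witnesses that `d` is positive and provides the vertex `w₀` outside `V₁`.
  (i₀ : Fin d)
  where

  open Bipartition X bipartition
  module M = Cardinality meets
  module C = Cardinality (subset-cardinality B)

  e : Fin d → Permutation′ n
  e i = proj₁ (proj₁ (M.element∈ i))

  e∈G : ∀ i → e i ∈ₛ G
  e∈G i = proj₁ (proj₂ (proj₁ (M.element∈ i)))

  B^e : ∀ i → B ^ e i ≡ M.element i
  B^e i = proj₂ (proj₂ (proj₁ (M.element∈ i)))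

  x : Fin d → Fin n
  x i = proj₁ (proj₂ (M.element∈ i))

  v~x : ∀ i → Adj X v (x i)
  v~x i = ∈N⁻ X (proj₁ (x∈p∩q⁻ _ _ (proj₂ (proj₂ (M.element∈ i)))))

  x∈B^e : ∀ i → x i ∈ B ^ e i
  x∈B^e i = subst (x i ∈_) (sym (B^e i)) (proj₂ (x∈p∩q⁻ _ _ (proj₂ (proj₂ (M.element∈ i)))))

  -- For `g` in `G`, this parametrizes the union of the `d` translates that meet the neighbourhood
  -- of `g ⟨$⟩ʳ v`: `i` selects the translate and `j` a point of it.
  Φ : Permutation′ n → Fin d × Fin ∣ B ∣ → Fin n
  Φ g (i , j) = g ⟨$⟩ʳ (e i ⟨$⟩ʳ C.element j)

  Φ∈ : ∀ g c → Φ g c ∈ B ^ (e (proj₁ c) ∘ₚ g)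
  Φ∈ g (i , j) = ∈^⁺ B (e i ∘ₚ g) (C.element∈ j)

  Φ-onto : ∀ g i {u} → u ∈ B ^ (e i ∘ₚ g) → ∃ λ j → Φ g (i , j) ≡ u
  Φ-onto g i u∈ = let b , b∈ , eq = ∈^⁻ B (e i ∘ₚ g) u∈ in
    C.index b∈ , trans (cong (e i ∘ₚ g ⟨$⟩ʳ_) (C.element-index b∈)) eq

  -- After cancelling `g`, a common point makes the translates by `e i` and `e i′` equal, and the
  -- enumeration in `meets` has no repetitions; so `i` and `i′` agree, and then so do `j` and `j′`.
  Φ-injective : ∀ g → Injective _≡_ _≡_ (Φ g)
  Φ-injective g {i , j} {i′ , j′} eq
    with eq′ ← ⟨$⟩ʳ-injective g eq
    with refl ← M.element-injective (trans (sym (B^e i)) (trans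
           (translates-≡ G block (e∈G i) (e∈G i′) (∈^⁺ B (e i) (C.element∈ j))
             (subst (_∈ B ^ e i′) (sym eq′) (∈^⁺ B (e i′) (C.element∈ j′))))
           (B^e i′)))
    = cong (i ,_) (C.element-injective (⟨$⟩ʳ-injective (e i) eq′))

  -- As `B` lies in `V₁`, its translate by `e i` lies in a single side. This is the side of `x i`, a
  -- neighbour of `v`, hence the side opposite to `v`; moving everything by `g` keeps sides
  -- opposite.
  side-Φ : ∀ {g} → g ∈ₛ G → ∀ c → side (Φ g c) xor side (g ⟨$⟩ʳ v) ≡ true
  side-Φ {g} g∈ (i , j) = let b , b∈ , eb≡x = ∈^⁻ B (e i) (x∈B^e i) in begin
    side (Φ g (i , j)) xor side (g ⟨$⟩ʳ v)
      ≡⟨ automorphism-side g (G≤X g g∈) (connected _ v) ⟩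
    side (e i ⟨$⟩ʳ C.element j) xor side v
      ≡⟨ cong (_xor side v) (same {e i ⟨$⟩ʳ C.element j} {e i ⟨$⟩ʳ b}
           (trans (automorphism-side (e i) (G≤X (e i) (e∈G i)) (connected _ b))
                  (cong₂ _xor_ ([]=⇒lookup (B⊆V₁ (C.element∈ j))) ([]=⇒lookup (B⊆V₁ b∈))))) ⟩
    side (e i ⟨$⟩ʳ b) xor side v
      ≡⟨ cong (λ y → side y xor side v) eb≡x ⟩
    side (x i) xor side v
      ≡⟨ cong (_xor side v) (side-adj (symm X (v~x i))) ⟩
    not (side v) xor side v
      ≡⟨ Bool.xor-inverseˡ (side v) ⟩
    true ∎
    where
    open ≡.≡-Reasoning
    same : ∀ {u w} → side u xor side w ≡ false → side u ≡ side w
    same {u} {w} eq with side u | side w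
    same eq | true  | true  = refl
    same eq | false | false = refl

  to : Fin n → Permutation′ n
  to u = proj₁ (transitive v u)

  to∈G : ∀ u → to u ∈ₛ G
  to∈G u = proj₁ (proj₂ (transitive v u))

  to-v : ∀ u → to u ⟨$⟩ʳ v ≡ u
  to-v u = proj₂ (proj₂ (transitive v u))

  Φ∈V₁ : ∀ {w} → w ∉ V₁ → ∀ c → Φ (to w) c ∈ V₁
  Φ∈V₁ {w} w∉ c = lookup⇒[]= _ V₁ (begin
    side (Φ (to w) c)                              ≡⟨ Bool.xor-identityʳ _ ⟨
    side (Φ (to w) c) xor false                    ≡⟨ cong (side (Φ (to w) c) xor_) (side-false w∉) ⟨
    side (Φ (to w) c) xor side w                   ≡⟨ cong (λ y → side (Φ (to w) c) xor side y) (to-v w) ⟨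
    side (Φ (to w) c) xor side (to w ⟨$⟩ʳ v)       ≡⟨ side-Φ (to∈G w) c ⟩
    true                                           ∎)
    where open ≡.≡-Reasoning

  Φ∉V₁ : ∀ c → Φ Perm.id c ∉ V₁
  Φ∉V₁ c Φ∈ with () ← trans (sym (side-Φ (id∈ G) c))
    (cong₂ _xor_ ([]=⇒lookup Φ∈) ([]=⇒lookup (B⊆V₁ v∈B)))

  φ : Permutation′ n → Fin (d * ∣ B ∣) → Fin n
  φ g c = Φ g (remQuot ∣ B ∣ c)

  φ-injective : ∀ g → Injective _≡_ _≡_ (φ g)
  φ-injective g {c} {c′} eq = trans (sym (combine-remQuot {d} ∣ B ∣ c))
    (trans (cong (λ (i , j) → combine i j) (Φ-injective g eq)) (combine-remQuot {d} ∣ B ∣ c′))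

  w₀ : Fin n
  w₀ = x i₀

  w₀∉V₁ : w₀ ∉ V₁
  w₀∉V₁ w₀∈ with () ← trans (sym ([]=⇒lookup w₀∈))
    (trans (side-adj (symm X (v~x i₀))) (cong not ([]=⇒lookup (B⊆V₁ v∈B))))

  2*d*∣B∣≡n : 2 * (d * ∣ B ∣) ≡ n
  2*d*∣B∣≡n = trans (sym (*-assoc 2 d ∣ B ∣)) (trans (*-comm (2 * d) ∣ B ∣) ∣B∣*2d≡n)

  -- The translates around `v`, a vertex of `V₁`, put `d * ∣ B ∣` points into the complement of
  -- `V₁`, which leaves at most half of the vertices for `V₁`.
  ∣V₁∣≤d*∣B∣ : ∣ V₁ ∣ ≤ d * ∣ B ∣
  ∣V₁∣≤d*∣B∣ = +-cancelˡ-≤ (d * ∣ B ∣) _ _ (begin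
    d * ∣ B ∣ + ∣ V₁ ∣
      ≤⟨ m≤o∸n⇒m+n≤o (d * ∣ B ∣) (∣p∣≤n V₁) (subst (d * ∣ B ∣ ≤_) (∣∁p∣≡n∸∣p∣ V₁) d*∣B∣≤∣∁V₁∣) ⟩
    n
      ≡⟨ 2*d*∣B∣≡n ⟨
    2 * (d * ∣ B ∣)
      ≡⟨ cong (d * ∣ B ∣ +_) (+-identityʳ (d * ∣ B ∣)) ⟩
    d * ∣ B ∣ + d * ∣ B ∣ ∎)
    where
    open ≤-Reasoning
    d*∣B∣≤∣∁V₁∣ = injective⇒≤∣p∣ (φ-injective Perm.id) λ c → x∉p⇒x∈∁p (Φ∉V₁ (remQuot _ c))

  ∣V₁∣≡d*∣B∣ : ∣ V₁ ∣ ≡ d * ∣ B ∣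
  ∣V₁∣≡d*∣B∣ = ≤-antisym ∣V₁∣≤d*∣B∣
    (injective⇒≤∣p∣ (φ-injective (to w₀)) λ c → Φ∈V₁ w₀∉V₁ (remQuot _ c))

  -- The translates around `w` already supply as many distinct points of `V₁` as `V₁` can hold, so
  -- they cover it.
  Φ-onto-V₁ : ∀ {w} → w ∉ V₁ → ∀ {u} → u ∈ V₁ → ∃ λ c → Φ (to w) c ≡ u
  Φ-onto-V₁ {w} w∉ u∈ =
    let c , eq = injective⇒onto (φ-injective (to w)) (λ c → Φ∈V₁ w∉ (remQuot _ c)) ∣V₁∣≤d*∣B∣ u∈
    in remQuot ∣ B ∣ c , eq

  -- The colour classes are the translates around the one fixed vertex `w₀`.
  colour : ∀ {u} → u ∈ V₁ → Fin d
  colour u∈ = proj₁ (proj₁ (Φ-onto-V₁ w₀∉V₁ u∈))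

  f : Fin n → Subset d
  f u with u ∈? V₁
  ... | yes u∈ = ⁅ colour u∈ ⁆
  ... | no  _  = ⊥

  ∣f∣ : ∀ u → ∣ f u ∣ ≡ ⟦ side u ⟧
  ∣f∣ u with u ∈? V₁
  ... | yes u∈ = trans (∣⁅x⁆∣≡1 (colour u∈)) (cong ⟦_⟧ (sym ([]=⇒lookup u∈)))
  ... | no  u∉ = trans (∣⊥∣≡0 d) (cong ⟦_⟧ (sym (side-false u∉)))

  f≡⊥⇒∉V₁ : ∀ {u} → f u ≡ ⊥ → u ∉ V₁
  f≡⊥⇒∉V₁ {u} fu≡⊥ with u ∈? V₁
  ... | yes u∈ = contradiction (subst (colour u∈ ∈_) fu≡⊥ (x∈⁅x⁆ (colour u∈))) ∉⊥
  ... | no  u∉ = u∉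

  -- The colour comes from some chosen preimage of `u` under `Φ (to w₀)`; by injectivity it is the
  -- preimage with first component `i`.
  f-translate : ∀ {i u} → u ∈ V₁ → u ∈ B ^ (e i ∘ₚ to w₀) → i ∈ f u
  f-translate {i} {u} u∈ u∈Bᵢ with u ∈? V₁
  ... | no  u∉ = contradiction u∈ u∉
  ... | yes u∈′ =
    let j , eq = Φ-onto (to w₀) i u∈Bᵢ
        eq′ = proj₂ (Φ-onto-V₁ w₀∉V₁ u∈′)
    in subst (_∈ ⁅ colour u∈′ ⁆) (cong proj₁ (Φ-injective (to w₀) (trans eq′ (sym eq))))
         (x∈⁅x⁆ (colour u∈′))

  -- A point of the `i`-th colour class also lies in some translate around `w`, say the `i′`-th.
  -- Sharing a point, the two translates coincide, and the latter contains the image of `x i′`, a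
  -- neighbour of `w`.
  rainbow-neighbour : ∀ {w} → w ∉ V₁ → ∀ i → ∃ λ u → Adj X w u × i ∈ f u
  rainbow-neighbour {w} w∉ i =
    -- Any point of the class would do; `v` serves as the known point of `B`.
    let (i′ , j′) , eq = Φ-onto-V₁ w∉ (Φ∈V₁ w₀∉V₁ (i , C.index v∈B))
        u = to w ⟨$⟩ʳ x i′
        w~u = subst (λ z → Adj X z u) (to-v w)
                (Equivalence.to (G≤X (to w) (to∈G w) v (x i′)) (v~x i′))
        b , b∈ , eb≡x = ∈^⁻ B (e i′) (x∈B^e i′)
        u∈ : u ∈ B ^ (e i′ ∘ₚ to w)
        u∈ = subst (λ z → to w ⟨$⟩ʳ z ∈ B ^ (e i′ ∘ₚ to w)) eb≡x (∈^⁺ B (e i′ ∘ₚ to w) b∈)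
        same = translates-≡ G block
          (∘-closed G (e∈G i′) (to∈G w)) (∘-closed G (e∈G i) (to∈G w₀))
          (subst (_∈ B ^ (e i′ ∘ₚ to w)) eq (Φ∈ (to w) (i′ , j′)))
          (Φ∈ (to w₀) (i , C.index v∈B))
        u∈V₁ = lookup⇒[]= u V₁ (trans (side-adj (symm X w~u)) (cong not (side-false w∉)))
    in u , w~u , f-translate u∈V₁ (subst (u ∈_) same u∈)

  f-isRDF : IsRDF d X f
  f-isRDF w fw≡⊥ = ⊆-antisym ⊆⊤ λ {i} _ →
    let u , w~u , i∈fu = rainbow-neighbour (f≡⊥⇒∉V₁ fw≡⊥) i
    in x∈⋃⁺ (∈-map⁺ f (∈-filter⁺ (_∈? N X w) (∈-allFin u) (∈N⁺ X w~u))) i∈fu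

  2*weight≡n : 2 * weight f ≡ n
  2*weight≡n = trans (cong (2 *_) (begin
    weight f                 ≡⟨ sum-cong-≗ ∣f∣ ⟩
    sum (λ u → ⟦ side u ⟧)   ≡⟨ ∣p∣≡∑ V₁ ⟨
    ∣ V₁ ∣                   ≡⟨ ∣V₁∣≡d*∣B∣ ⟩
    d * ∣ B ∣                ∎)) 2*d*∣B∣≡n
    where open ≡.≡-Reasoning

  isRDR : IsRDR d X
  isRDR = regular , weight f , ((f , f-isRDF , refl) , minimal) , 2*weight≡n
    where
    minimal : ∀ f′ → IsRDF d X f′ → weight f ≤ weight f′
    minimal f′ rdf′ = *-cancelˡ-≤ 2
      (subst (_≤ 2 * weight f′) (sym 2*weight≡n) (n≤2*weight X {{nonZeroIndex i₀}} regular rdf′))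

theorem3p4 : ∀ (n d : ℕ) (X : Graph n) →
    IsConnected X → IsVertexTransitive X → IsRegular X d →
    ∀ (V₁ V₂ : Subset n) → IsBipartition X V₁ V₂ →
    ∀ (G : Subgroup n) → G ≤Aut X → IsTransitive G →
    -- m is the number n / (2d)
    ∀ (m : ℕ) → m * (2 * d) ≡ n →
    ∀ (B : Subset n) → IsBlock G B → ∣ B ∣ ≡ m → B ⊆ V₁ →
    ∀ (v : Fin n) → v ∈ B → MeetsExactly X G B v d →
    IsRDR d X
    × ∃ λ (H : Subgroup n) →
        H ≤ₛ G
        × IsOrbit H B
        × (∃ λ h → HasOrder H h × m ∣ h)
        × ContainsStabilizer H G v
-- With `d` zero the order equation forces `n` to be zero, which contradicts the existence of `v`.
theorem3p4 n zero X _ _ _ _ _ _ _ _ _ m m*0≡n _ _ _ _ v _ _ =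
  contradiction (subst Fin (trans (sym m*0≡n) (*-zeroʳ m)) v) ¬Fin0
theorem3p4 n (suc d) X connected _ regular V₁ V₂ bipartition G G≤X transitive
           m m*2d≡n B block refl B⊆V₁ v v∈B meets =
    Rainbow.isRDR X connected regular bipartition G G≤X transitive m*2d≡n block B⊆V₁ v∈B meets zero
  , setwiseStabilizer G B
  , (λ _ → proj₁)
  , (v , orbit)
  , (let k , order = orbit-stabilizer (setwiseStabilizer G B) orbit in m * k , order , m∣m*n k)
  , setwiseStabilizer-stabilizer G transitive block v∈B
  where orbit = setwiseStabilizer-orbit G transitive block v∈B
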